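{- Let $H$ be a chordal graph, let $t \geq 1$, and let $G = \mathrm{CCG}(H, V(H), t)$. If $r$ is a positive integer with $r \leq 2t+1$, then the $r$-independence complex $\mathrm{Ind}_r(G)$ is shellable.
   Context: All graphs are finite and simple; a graph is chordal if every cycle of length at least 4 has a chord. A star-clique graph $\mathrm{SC}(x)$ is a graph formed by attaching a collection of cliques $B_1,\dots,B_m$ (complete graphs, possibly of different sizes) to a central vertex $x$, i.e. each $B_i$ contains $x$ and the $B_i$ share no other vertices. For a vertex cover $S$ of $H$ and integer $t\ge1$, $\mathrm{CCG}(H,S,t)$ is the graph obtained from $H$ by attaching to each vertex $x \in S$ a star-clique graph $\mathrm{SC}(x)$ with center $x$ and $|V(\mathrm{SC}(x))| \geq t+1$, whose vertices other than $x$ are new (not in $H$ and not in any other attached star-clique). For $r \geq 1$, a subset $A \subseteq V(G)$ is $r$-independent if every connected component of $G[A]$ has at most $r$ vertices; $\mathrm{Ind}_r(G)$ is the simplicial complex on $V(G)$ of all $r$-independent subsets. A (not necessarily pure) simplicial complex is shellable if its facets can be ordered $F_1,\dots,F_k$ so that for each $j>1$, $\langle F_j\rangle \cap \langle F_1,\dots,F_{j-1}\rangle$ is pure of dimension $\dim F_j-1$ ($\langle\mathcal F\rangle$ = complex generated by $\mathcal F$). -}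

module Defs where

open import Data.Nat using (ℕ; zero; suc; _+_; _≤_; _<_)
open import Data.Fin using (Fin; toℕ) renaming (_<_ to _<ᶠ_)
open import Data.Fin.Subset using (Subset; _∈_; _∉_; _⊆_; ∣_∣)
open import Data.Bool using (Bool; true; false)
open import Data.Product using (Σ; ∃; ∃-syntax; _×_; _,_)
open import Data.Sum using (_⊎_; inj₁; inj₂)
open import Relation.Nullary using (¬_)
open import Relation.Binary.PropositionalEquality using (_≡_; _≢_)
open import Function.Definitions using (Injective)

record Graph (n : ℕ) : Set where
  field
    adj    : Fin n → Fin n → Bool
    sym    : ∀ u v → adj u v ≡ adj v u
    irrefl : ∀ v → adj v v ≡ false

open Graph public

Edge : ∀ {n} → Graph n → Fin n → Fin n → Set
Edge G u v = adj G u v ≡ true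

CycAdj : (k : ℕ) → Fin k → Fin k → Set
CycAdj k i j =
    (suc (toℕ i) ≡ toℕ j) ⊎ (suc (toℕ j) ≡ toℕ i)
  ⊎ ((toℕ i ≡ 0) × (suc (toℕ j) ≡ k)) ⊎ ((toℕ j ≡ 0) × (suc (toℕ i) ≡ k))

IsCycle : ∀ {n} → Graph n → (k : ℕ) → (Fin k → Fin n) → Set
IsCycle G k c = Injective _≡_ _≡_ c × (∀ i j → CycAdj k i j → Edge G (c i) (c j))

HasChord : ∀ {n} → Graph n → (k : ℕ) → (Fin k → Fin n) → Set
HasChord G k c = ∃[ i ] ∃[ j ] (i ≢ j × ¬ CycAdj k i j × Edge G (c i) (c j))

Chordal : ∀ {n} → Graph n → Set
Chordal G = ∀ k → 4 ≤ k → (c : Fin k → Fin _) → IsCycle G k c → HasChord G k c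

-- G is (isomorphic to) CCG(H, V(H), t).
-- Each vertex v of G has a role: either it is (the copy of) a vertex a of H
-- (inj₁ a), or it is a new vertex belonging to the star-clique SC(x)
-- attached at x, lying in the clique labelled b (inj₂ (x , b)).

Role : ℕ → Set
Role n = Fin n ⊎ (Fin n × ℕ)

record IsCCGAll {n N : ℕ} (H : Graph n) (G : Graph N) (t : ℕ) : Set where
  field
    role   : Fin N → Role n
    copy   : Fin n → Fin N
    copy-role : ∀ a → role (copy a) ≡ inj₁ a
    copy-uniq : ∀ v a → role v ≡ inj₁ a → v ≡ copy a
    adj-HH : ∀ a b → adj G (copy a) (copy b) ≡ adj H a b
    adj-HN : ∀ v a x b → role v ≡ inj₂ (x , b) →
               (Edge G v (copy a) → a ≡ x) × (a ≡ x → Edge G v (copy a))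
    adj-NN : ∀ v w x b y c → role v ≡ inj₂ (x , b) → role w ≡ inj₂ (y , c) →
               (Edge G v w → (x ≡ y × b ≡ c × v ≢ w)) ×
               ((x ≡ y × b ≡ c × v ≢ w) → Edge G v w)
    -- |V(SC(x))| ≥ t + 1, i.e. SC(x) has at least t new vertices
    size   : ∀ x → Σ (Fin t → Fin N) λ f →
               Injective _≡_ _≡_ f × (∀ i → ∃[ b ] role (f i) ≡ inj₂ (x , b))

data Reach {N} (G : Graph N) (A : Subset N) (u : Fin N) : Fin N → Set where
  here : u ∈ A → Reach G A u u
  step : ∀ {v w} → Reach G A u v → w ∈ A → Edge G v w → Reach G A u w

-- every connected component of G[A] has at most r vertices
-- (no r+1 distinct vertices lie in the component of any vertex)
RIndep : ∀ {N} → ℕ → Graph N → Subset N → Set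
RIndep r G A = ∀ u (f : Fin (suc r) → Fin _) → Injective _≡_ _≡_ f →
               ¬ (∀ i → Reach G A u (f i))

Complex : ℕ → Set₁
Complex N = Subset N → Set

Ind : ∀ {N} → ℕ → Graph N → Complex N
Ind r G = RIndep r G

IsFacet : ∀ {N} → Complex N → Subset N → Set
IsFacet Δ F = Δ F × (∀ F' → Δ F' → F ⊆ F' → F' ⊆ F)

Inter : ∀ {N k} → (Fin k → Subset N) → Fin k → Complex N
Inter F j σ = σ ⊆ F j × ∃[ i ] (i <ᶠ j × σ ⊆ F i)

-- Shellability (not necessarily pure): an ordering F_0, …, F_{k-1} of all facets
-- such that for j > 0, ⟨F_j⟩ ∩ ⟨F_0,…,F_{j-1}⟩ is pure of dimension dim F_j - 1,
-- i.e. all its facets have ∣ F_j ∣ - 1 vertices.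
Shellable : ∀ {N} → Complex N → Set
Shellable {N} Δ =
  Σ ℕ λ k → Σ (Fin k → Subset N) λ F →
      Injective _≡_ _≡_ F
    × (∀ i → IsFacet Δ (F i))
    × (∀ σ → IsFacet Δ σ → ∃[ i ] F i ≡ σ)
    × (∀ j → 0 < toℕ j → ∀ σ → IsFacet (Inter F j) σ → suc ∣ σ ∣ ≡ ∣ F j ∣)

{-# OPTIONS --safe #-}
-- Ind_r(G) is vertex decomposable, hence shellable by listing the facets avoiding a shedding
-- vertex before those containing it.  The vertices of H are decided first.  An undecided vertex
-- adjacent to one already chosen sheds: a facet avoiding it which it could enlarge would contain
-- two full star-cliques, at least 2t + 2 > r connected vertices.  A vertex x whose star-clique
-- is not a face sheds as well.  Otherwise, if undecided x ~ y satisfy N[x] ⊆ N[y], then y sheds: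
-- a facet avoiding y contains x or a neighbour of x, both of which are adjacent to y.  Such a
-- pair exists at the end of a maximal induced path, since H is chordal.  If there is no edge
-- left, x is in every facet.  Once H is decided, the undecided new vertices in one component are
-- interchangeable, so each one is either a cone point or a shedding vertex.
module Submission where

open import Defs
open import Data.Nat using (ℕ; _≤_; _+_; _*_)
open import Data.Nat using (zero; suc; _<_; z≤n; s≤s; _<?_)
open import Data.Nat.Properties as ℕₚ using (≤-refl; ≤-trans; ≤-reflexive)
open import Data.Fin using (Fin; zero; suc; toℕ; splitAt; join; inject≤)
open import Data.Fin.Properties as Finₚ using (any?; toℕ<n; toℕ-injective)
open import Data.Fin.Subset using (Subset; _∈_; _∉_; _⊆_; ∣_∣; _∪_; _-_; ⁅_⁆)
  renaming (⊤ to ⊤ˢ; ⊥ to ⊥ˢ)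
open import Data.Fin.Subset.Properties as Subₚ using (_∈?_)
open import Data.Bool using (true; false)
import Data.Bool as Bool
open import Data.Empty using (⊥; ⊥-elim)
open import Data.Unit using (⊤; tt)
open import Data.List using (List; []; _∷_; _++_; length; lookup)
import Data.List.Membership.Propositional as List
open import Data.List.Membership.Propositional.Properties using (∈-++⁺ˡ; ∈-++⁺ʳ; ∈-++⁻; ∈-lookup)
open import Data.List.Relation.Unary.Any using (here; there; index)
open import Data.List.Relation.Unary.Any.Properties using (lookup-index)
open import Data.Product using (Σ; ∃; ∃-syntax; _×_; _,_; proj₁; proj₂)
open import Data.Sum using (_⊎_; inj₁; inj₂; [_,_]′)
import Data.Sum as Sum
open import Data.Vec using ([]; _∷_; here; there; tabulate)
open import Data.Vec.Properties using (lookup∘tabulate; lookup⇒[]=; []=⇒lookup)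
open import Function using (_∘_; id)
open import Function.Definitions using (Injective)
open import Relation.Binary using (tri<; tri≈; tri>)
open import Relation.Binary.PropositionalEquality
  using (_≡_; _≢_; refl; cong; subst; trans) renaming (sym to ≡-sym)
open import Relation.Nullary using (¬_; Dec; yes; no; does)
open import Relation.Nullary.Decidable using (_×-dec_; ¬?; decidable-stable; dec-true)
open import Relation.Unary using (Decidable)

-- Finite subsets

infixl 6 _⊕_
_⊕_ : ∀ {n} → Subset n → Fin n → Subset n
F ⊕ u = F ∪ ⁅ u ⁆

module _ {n : ℕ} where

  ⊆⊕ : ∀ (F : Subset n) u → F ⊆ F ⊕ u
  ⊆⊕ F u = Subₚ.p⊆p∪q ⁅ u ⁆

  ∈⊕ : ∀ (F : Subset n) u → u ∈ F ⊕ u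
  ∈⊕ F u = Subₚ.q⊆p∪q F ⁅ u ⁆ (Subₚ.x∈⁅x⁆ u)

  ∈⊕⁻ : ∀ (F : Subset n) u {v} → v ∈ F ⊕ u → v ∈ F ⊎ v ≡ u
  ∈⊕⁻ F u = Sum.map₂ (Subₚ.x∈⁅y⁆⇒x≡y u) ∘ Subₚ.x∈p∪q⁻ F ⁅ u ⁆

  ⊕-least : ∀ {F X : Subset n} {u} → F ⊆ X → u ∈ X → F ⊕ u ⊆ X
  ⊕-least {F} F⊆X u∈X v∈ with ∈⊕⁻ F _ v∈
  ... | inj₁ v∈F  = F⊆X v∈F
  ... | inj₂ refl = u∈X

  -⊆ : ∀ (D : Subset n) u → D - u ⊆ D
  -⊆ D u = Subₚ.p─q⊆p D ⁅ u ⁆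

  ∣⊕∣ : ∀ {A : Subset n} {u} → u ∉ A → ∣ A ∣ < ∣ A ⊕ u ∣
  ∣⊕∣ {A} {u} u∉A = Subₚ.p⊂q⇒∣p∣<∣q∣ (⊆⊕ A u , u , ∈⊕ A u , u∉A)

∉- : ∀ {n} (D : Subset n) u → u ∉ D - u
∉- (s ∷ D) (suc u) (there u∈) = ∉- D u u∈

∣-∣ : ∀ {n} (D : Subset n) u → u ∈ D → suc ∣ D - u ∣ ≡ ∣ D ∣
∣-∣ (true ∷ D) zero    here        = cong (suc ∘ ∣_∣) (Subₚ.p─⊥≡p D)
∣-∣ (true ∷ D) (suc u) (there u∈)  = cong suc (∣-∣ D u u∈)
∣-∣ (false ∷ D) (suc u) (there u∈) = ∣-∣ D u u∈

module _ {n : ℕ} {P : Fin n → Set} (P? : Decidable P) where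

  comprehension : Subset n
  comprehension = tabulate (does ∘ P?)

  ∈-comprehension⁺ : ∀ {v} → P v → v ∈ comprehension
  ∈-comprehension⁺ {v} p =
    lookup⇒[]= v _ (trans (lookup∘tabulate _ v) (dec-true (P? v) p))

  ∈-comprehension⁻ : ∀ {v} → v ∈ comprehension → P v
  ∈-comprehension⁻ {v} v∈ with P? v | trans (≡-sym (lookup∘tabulate (does ∘ P?) v)) ([]=⇒lookup v∈)
  ... | yes p | _ = p

enumerate : ∀ {n} (C : Subset n) →
            Σ (Fin ∣ C ∣ → Fin n) λ f → Injective _≡_ _≡_ f × (∀ i → f i ∈ C)
enumerate [] = (λ ()) , (λ { {()} }) , λ ()
enumerate (false ∷ C) with enumerate C
... | f , inj , f∈ = suc ∘ f , inj ∘ Finₚ.suc-injective , there ∘ f∈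
enumerate {suc n} (true ∷ C) with enumerate C
... | f , inj , f∈ = g , g-inj , g∈
  where
  g : Fin (suc ∣ C ∣) → Fin (suc n)
  g zero    = zero
  g (suc i) = suc (f i)
  g-inj : Injective _≡_ _≡_ g
  g-inj {zero}  {zero}  _  = refl
  g-inj {suc i} {suc j} eq = cong suc (inj (Finₚ.suc-injective eq))
  g∈ : ∀ i → g i ∈ true ∷ C
  g∈ zero    = here
  g∈ (suc i) = there (f∈ i)

injective⇒≤∣∣ : ∀ {n} k (C : Subset n) (f : Fin k → Fin n) →
                Injective _≡_ _≡_ f → (∀ i → f i ∈ C) → k ≤ ∣ C ∣
injective⇒≤∣∣ zero    C f inj f∈ = z≤n
injective⇒≤∣∣ (suc k) C f inj f∈ =
  ≤-trans (s≤s (injective⇒≤∣∣ k (C - f zero) (f ∘ suc) (Finₚ.suc-injective ∘ inj)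
                 λ i → Subₚ.x∈p∧x≢y⇒x∈p-y (f∈ (suc i)) λ eq → Finₚ.0≢1+n (≡-sym (inj eq))))
          (≤-reflexive (∣-∣ C (f zero) (f∈ zero)))

-- The recursions on pairs of sets carry a fuel `m` bounding the number of elements of `D` outside
-- `A`, written without subtraction. Enlarging `A` or shrinking `D` spends one unit.
fuel-⊕ : ∀ {n} m (A D : Subset n) {u} → u ∉ A → ∣ D ∣ ≤ suc m + ∣ A ∣ → ∣ D ∣ ≤ m + ∣ A ⊕ u ∣
fuel-⊕ m A D u∉A le =
  ≤-trans le (≤-trans (≤-reflexive (≡-sym (ℕₚ.+-suc m ∣ A ∣))) (ℕₚ.+-monoʳ-≤ m (∣⊕∣ u∉A)))

fuel-- : ∀ {n} m (A D : Subset n) {u} → u ∈ D → ∣ D ∣ ≤ suc m + ∣ A ∣ → ∣ D - u ∣ ≤ m + ∣ A ∣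
fuel-- m A D u∈D le = ℕₚ.≤-pred (≤-trans (Subₚ.x∈p⇒∣p-x∣<∣p∣ u∈D) le)

no-fuel : ∀ {n} {A D : Subset n} {u} → A ⊆ D → u ∈ D → u ∉ A → ¬ (∣ D ∣ ≤ 0 + ∣ A ∣)
no-fuel A⊆D u∈D u∉A = ℕₚ.<⇒≱ (Subₚ.p⊂q⇒∣p∣<∣q∣ (A⊆D , _ , u∈D , u∉A))

-- Vertex decompositions and shellings

module Decomposition {N : ℕ} (Δ : Complex N) (Δ? : ∀ F → Dec (Δ F))
                     (down : ∀ {F X} → F ⊆ X → Δ X → Δ F) where

  -- A is the set of vertices linked so far, the complement of D the set deleted so far.
  record LocalFacet (A D F : Subset N) : Set where
    constructor localFacet
    field
      face    : Δ F
      lower   : A ⊆ F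
      upper   : F ⊆ D
      maximal : ∀ {v} → v ∈ D → v ∉ F → ¬ Δ (F ⊕ v)

  -- Vertex decompositions of the link of `A` in the restriction to `D`, with `A` kept in every
  -- face. The premise of `shed` makes each facet of the deletion stay maximal in `D`; in `cone` no
  -- facet avoids `u`, so there is no deletion branch.
  data Decomposable (A D : Subset N) : Set where
    nonface : ¬ Δ A → Decomposable A D
    leaf    : Δ A → A ⊆ D → D ⊆ A → Decomposable A D
    cone    : ∀ u → (∀ F → LocalFacet A D F → u ∈ F) →
              Decomposable (A ⊕ u) D → Decomposable A D
    shed    : ∀ u → u ∈ D → u ∉ A →
              (∀ F → LocalFacet A (D - u) F → ¬ Δ (F ⊕ u)) →
              Decomposable A (D - u) → Decomposable (A ⊕ u) D → Decomposable A D

  extend : ∀ {A D} m X → Δ X → A ⊆ X → X ⊆ D → ∣ D ∣ ≤ m + ∣ X ∣ →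
           ∃[ F ] LocalFacet A D F × X ⊆ F
  extend {A} {D} m X ΔX A⊆X X⊆D le
    with any? (λ v → (v ∈? D) ×-dec (¬? (v ∈? X) ×-dec Δ? (X ⊕ v)))
  ... | no none =
        X , localFacet ΔX A⊆X X⊆D (λ v∈D v∉X Δv → none (_ , v∈D , v∉X , Δv)) , id
  extend zero X ΔX A⊆X X⊆D le | yes (v , v∈D , v∉X , _) =
        ⊥-elim (no-fuel X⊆D v∈D v∉X le)
  extend {A} {D} (suc m) X ΔX A⊆X X⊆D le | yes (v , v∈D , v∉X , Δv)
    with extend m (X ⊕ v) Δv (⊆⊕ X v ∘ A⊆X) (⊕-least X⊆D v∈D) (fuel-⊕ m X D v∉X le)
  ... | F , lf , X⊆F = F , lf , X⊆F ∘ ⊆⊕ X v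

  -- Exchange form of the shelling condition for a new facet `F` and an earlier `F'`: their
  -- intersection lies in `F - u`, which has one vertex fewer than `F` and lies in the earlier facet
  -- `F″`.
  Separated : (Subset N → Set) → Subset N → Subset N → Set
  Separated P F F' = ∃[ u ] ∃[ F″ ] P F″ × u ∈ F × u ∉ F' × F - u ⊆ F″

  -- L can be appended to a shelling whose set of facets is P.
  Shells : (Subset N → Set) → List (Subset N) → Set
  Shells P []      = ⊤
  Shells P (F ∷ L) = (∀ F' → P F' → Separated P F F') × Shells (λ X → P X ⊎ X ≡ F) L

  separated-mono : ∀ {P Q F F'} → (∀ {X} → P X → Q X) → Separated P F F' → Separated Q F F'
  separated-mono i (u , F″ , p , rest) = u , F″ , i p , rest

  shells-resp : ∀ {P Q} L → (∀ {X} → P X → Q X) → (∀ {X} → Q X → P X) → Shells P L → Shells Q L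
  shells-resp []      i j s       = tt
  shells-resp (F ∷ L) i j (h , s) =
    (λ F' q → separated-mono i (h F' (j q))) , shells-resp L (Sum.map₁ i) (Sum.map₁ j) s

  shells-++ : ∀ {P} L₁ {L₂} → Shells P L₁ → Shells (λ X → P X ⊎ X List.∈ L₁) L₂ →
              Shells P (L₁ ++ L₂)
  shells-++ []       {L₂} s t = shells-resp L₂ (λ { (inj₁ p) → p ; (inj₂ ()) }) inj₁ t
  shells-++ {P} (F ∷ L₁) {L₂} (h , s) t = h , shells-++ L₁ s (shells-resp L₂ to from t)
    where
    to : ∀ {X} → P X ⊎ X List.∈ F ∷ L₁ → (P X ⊎ X ≡ F) ⊎ X List.∈ L₁
    to (inj₁ p)            = inj₁ (inj₁ p)
    to (inj₂ (here eq))    = inj₁ (inj₂ eq)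
    to (inj₂ (there X∈))   = inj₂ X∈
    from : ∀ {X} → (P X ⊎ X ≡ F) ⊎ X List.∈ L₁ → P X ⊎ X List.∈ F ∷ L₁
    from (inj₁ (inj₁ p))   = inj₁ p
    from (inj₁ (inj₂ eq))  = inj₂ (here eq)
    from (inj₂ X∈)         = inj₂ (there X∈)

  -- Used to place the facets through a shedding vertex after those avoiding it: they already shell
  -- among themselves, so only their separation from `Q` must be supplied.
  shells-after : ∀ {P Q} L → (∀ F → F List.∈ L → ∀ F' → Q F' → Separated Q F F') →
                 Shells P L → Shells (λ X → P X ⊎ Q X) L
  shells-after []      sep s       = tt
  shells-after (F ∷ L) sep (h , s) =
    (λ { F' (inj₁ p) → separated-mono inj₁ (h F' p)
       ; F' (inj₂ q) → separated-mono inj₂ (sep F (here refl) F' q) })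
    , shells-resp L [ Sum.map₁ inj₁ , inj₁ ∘ inj₂ ]′
                    [ Sum.map₁ inj₁ , inj₁ ∘ inj₂ ]′
                    (shells-after L (λ X → sep X ∘ there) s)

  FacetShelling : (A D : Subset N) → Set
  FacetShelling A D =
    Σ (List (Subset N)) λ L →
      (∀ {F} → F List.∈ L → LocalFacet A D F) × (∀ {F} → LocalFacet A D F → F List.∈ L)
      × Shells (λ _ → ⊥) L

  decomposable⇒shelling : ∀ {A D} → Decomposable A D → FacetShelling A D
  decomposable⇒shelling (nonface ¬ΔA) =
    [] , (λ ()) , (λ lf → ⊥-elim (¬ΔA (down (LocalFacet.lower lf) (LocalFacet.face lf)))) , tt
  decomposable⇒shelling {A} (leaf ΔA A⊆D D⊆A) =
    A ∷ [] , (λ { (here refl) → localFacet ΔA id A⊆D λ v∈D v∉A → ⊥-elim (v∉A (D⊆A v∈D)) })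
    , (λ (localFacet _ A⊆F F⊆D _) → here (Subₚ.⊆-antisym (D⊆A ∘ F⊆D) A⊆F))
    , (λ _ ()) , tt
  decomposable⇒shelling {A} (cone u apex vd) with decomposable⇒shelling vd
  ... | L , sound , complete , s =
    L , (λ F∈ → let localFacet f l p m = sound F∈ in localFacet f (l ∘ ⊆⊕ A u) p m)
      , (λ lf → let localFacet f l p m = lf in complete (localFacet f (⊕-least l (apex _ lf)) p m))
      , s
  decomposable⇒shelling {A} {D} (shed u u∈D u∉A shedding vd₁ vd₂)
    with decomposable⇒shelling vd₁ | decomposable⇒shelling vd₂
  ... | L₁ , sound₁ , complete₁ , s₁ | L₂ , sound₂ , complete₂ , s₂ =
    L₁ ++ L₂ , [ from₁ , from₂ ]′ ∘ ∈-++⁻ L₁ , to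
             , shells-++ L₁ s₁ (shells-after L₂ sep s₂)
    where
    from₁ : ∀ {F} → F List.∈ L₁ → LocalFacet A D F
    from₁ {F} F∈ with sound₁ F∈
    ... | lf@(localFacet f l p m) = localFacet f l (-⊆ D u ∘ p) maximal
      where
      maximal : ∀ {v} → v ∈ D → v ∉ F → ¬ Δ (F ⊕ v)
      maximal {v} v∈D v∉F with v Finₚ.≟ u
      -- `F` is known to be maximal only in `D - u`; the shedding premise excludes the one further
      -- candidate.
      ... | yes refl = shedding F lf
      ... | no  v≢u  = m (Subₚ.x∈p∧x≢y⇒x∈p-y v∈D v≢u) v∉F
    from₂ : ∀ {F} → F List.∈ L₂ → LocalFacet A D F
    from₂ F∈ = let localFacet f l p m = sound₂ F∈ in localFacet f (l ∘ ⊆⊕ A u) p m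
    to : ∀ {F} → LocalFacet A D F → F List.∈ L₁ ++ L₂
    to {F} (localFacet f l p m) with u ∈? F
    ... | yes u∈F = ∈-++⁺ʳ L₁ (complete₂ (localFacet f (⊕-least l u∈F) p m))
    ... | no  u∉F = ∈-++⁺ˡ (complete₁ (localFacet f l
            (λ v∈F → Subₚ.x∈p∧x≢y⇒x∈p-y (p v∈F) λ { refl → u∉F v∈F }) (m ∘ -⊆ D u)))
    -- `F - u` is a face avoiding `u`, so it grows to a facet of the deletion. That member of `L₁`
    -- serves as witness, whatever `F'` is.
    sep : ∀ F → F List.∈ L₂ → ∀ F' → F' List.∈ L₁ → Separated (List._∈ L₁) F F'
    sep F F∈ F' F'∈ with sound₂ F∈
    ... | localFacet f l p _
      with extend ∣ D - u ∣ (F - u) (down (-⊆ F u) f)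
             (λ v∈A → Subₚ.x∈p∧x≢y⇒x∈p-y (l (⊆⊕ A u v∈A)) λ { refl → u∉A v∈A })
             (λ v∈ → Subₚ.x∈p∧x≢y⇒x∈p-y (p (-⊆ F u v∈)) λ { refl → ∉- F u v∈ })
             (ℕₚ.m≤m+n _ _)
    ... | F″ , lf , F-u⊆F″ =
      u , F″ , complete₁ lf , l (∈⊕ A u)
      , (λ u∈F' → ∉- D u (LocalFacet.upper (sound₁ F'∈) u∈F')) , F-u⊆F″

  -- Stated for any `P`, the facets placed before `L`, because the induction moves the head of the
  -- list into `P`.
  shells-lookup : ∀ {P} L → Shells P L → ∀ j F' →
                  P F' ⊎ (∃[ i ] toℕ i < toℕ j × lookup L i ≡ F') →
                  Separated (λ X → P X ⊎ (∃[ k ] toℕ k < toℕ j × lookup L k ≡ X)) (lookup L j) F'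
  shells-lookup (F ∷ L) (h , s) zero    F' (inj₁ p) = separated-mono inj₁ (h F' p)
  shells-lookup {P} (F ∷ L) (h , s) (suc j) F' q =
    separated-mono back (shells-lookup L s j F' (forth q))
    where
    forth : P F' ⊎ (∃[ i ] toℕ i < suc (toℕ j) × lookup (F ∷ L) i ≡ F') →
            (P F' ⊎ F' ≡ F) ⊎ (∃[ i ] toℕ i < toℕ j × lookup L i ≡ F')
    forth (inj₁ p)                   = inj₁ (inj₁ p)
    forth (inj₂ (zero  , _ , eq))    = inj₁ (inj₂ (≡-sym eq))
    forth (inj₂ (suc i , s≤s lt , eq)) = inj₂ (i , lt , eq)
    back : ∀ {X} → (P X ⊎ X ≡ F) ⊎ (∃[ i ] toℕ i < toℕ j × lookup L i ≡ X) →
           P X ⊎ (∃[ i ] toℕ i < suc (toℕ j) × lookup (F ∷ L) i ≡ X)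
    back (inj₁ (inj₁ p))       = inj₁ p
    back (inj₁ (inj₂ eq))      = inj₂ (zero , s≤s z≤n , ≡-sym eq)
    back (inj₂ (i , lt , eq))  = inj₂ (suc i , s≤s lt , eq)

  decomposable⇒shellable : Decomposable ⊥ˢ ⊤ˢ → Shellable Δ
  decomposable⇒shellable vd with decomposable⇒shelling vd
  ... | L , sound , complete , s =
    length L , lookup L , injective , isFacet
    , (λ σ fσ → let σ∈ = complete (toLocal fσ) in index σ∈ , ≡-sym (lookup-index σ∈))
    , λ j _ → pure j
    where
    separated : ∀ {i j} → toℕ i < toℕ j →
      ∃[ u ] ∃[ k ] toℕ k < toℕ j × u ∈ lookup L j × u ∉ lookup L i × lookup L j - u ⊆ lookup L k
    separated {i} {j} i<j with shells-lookup L s j (lookup L i) (inj₂ (i , i<j , refl))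
    ... | u , _ , inj₂ (k , k<j , refl) , rest = u , k , k<j , rest
    -- Equal entries cannot be separated: `u` would lie in the later one and not in the earlier.
    injective : Injective _≡_ _≡_ (lookup L)
    injective {i} {j} eq with ℕₚ.<-cmp (toℕ i) (toℕ j)
    ... | tri≈ _ e _ = toℕ-injective e
    ... | tri< i<j _ _ = let u , _ , _ , u∈ , u∉ , _ = separated i<j in
                         ⊥-elim (u∉ (subst (u ∈_) (≡-sym eq) u∈))
    ... | tri> _ _ j<i = let u , _ , _ , u∈ , u∉ , _ = separated j<i in
                         ⊥-elim (u∉ (subst (u ∈_) eq u∈))
    isFacet : ∀ i → IsFacet Δ (lookup L i)
    isFacet i with sound (∈-lookup {xs = L} i)
    ... | localFacet f _ _ m = f , λ X ΔX F⊆X {v} v∈X →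
      decidable-stable (v ∈? lookup L i) λ v∉F → m Subₚ.∈⊤ v∉F (down (⊕-least F⊆X v∈X) ΔX)
    toLocal : ∀ {σ} → IsFacet Δ σ → LocalFacet ⊥ˢ ⊤ˢ σ
    toLocal {σ} (Δσ , m) =
      localFacet Δσ Subₚ.⊥⊆ Subₚ.⊆⊤ λ {v} _ v∉σ Δv → v∉σ (m _ Δv (⊆⊕ σ v) (∈⊕ σ v))
    -- `σ` misses `u` because it lies in `lookup L i`, so it is contained in `lookup L j - u`. That
    -- set belongs to the intersection too, and maximality of `σ` forces equality.
    pure : ∀ j σ → IsFacet (Inter (lookup L) j) σ → suc ∣ σ ∣ ≡ ∣ lookup L j ∣
    pure j σ ((σ⊆Fj , i , i<j , σ⊆Fi) , m) with separated i<j
    ... | u , k , k<j , u∈ , u∉ , sub = trans (cong (suc ∘ ∣_∣) σ≡) (∣-∣ (lookup L j) u u∈)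
      where
      σ⊆ : σ ⊆ lookup L j - u
      σ⊆ v∈σ = Subₚ.x∈p∧x≢y⇒x∈p-y (σ⊆Fj v∈σ) λ { refl → u∉ (σ⊆Fi v∈σ) }
      σ≡ : σ ≡ lookup L j - u
      σ≡ = Subₚ.⊆-antisym σ⊆ (m _ (-⊆ (lookup L j) u , k , k<j , sub) σ⊆)

-- Components and r-independence

edge? : ∀ {n} (G : Graph n) u v → Dec (Edge G u v)
edge? G u v = adj G u v Bool.≟ true

edge-sym : ∀ {n} (G : Graph n) {u v} → Edge G u v → Edge G v u
edge-sym G {u} {v} e = trans (sym G v u) e

edge-irrefl : ∀ {n} (G : Graph n) {u} → ¬ Edge G u u
edge-irrefl G {u} e with trans (≡-sym e) (irrefl G u)
... | ()

module _ {N : ℕ} (G : Graph N) where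

  reach-source : ∀ {A u v} → Reach G A u v → u ∈ A
  reach-source (here u∈)   = u∈
  reach-source (step p _ _) = reach-source p

  reach-target : ∀ {A u v} → Reach G A u v → v ∈ A
  reach-target (here u∈)     = u∈
  reach-target (step _ w∈ _) = w∈

  reach-mono : ∀ {A B u v} → A ⊆ B → Reach G A u v → Reach G B u v
  reach-mono A⊆B (here u∈)     = here (A⊆B u∈)
  reach-mono A⊆B (step p w∈ e) = step (reach-mono A⊆B p) (A⊆B w∈) e

  reach-trans : ∀ {A u v w} → Reach G A u v → Reach G A v w → Reach G A u w
  reach-trans p (here _)      = p
  reach-trans p (step q w∈ e) = step (reach-trans p q) w∈ e

  reach-sym : ∀ {A u v} → Reach G A u v → Reach G A v u
  reach-sym (here u∈)     = here u∈
  reach-sym (step p w∈ e) =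
    reach-trans (step (here w∈) (reach-target p) (edge-sym G e)) (reach-sym p)

  reach-within : ∀ {A K u} → (∀ {v} → Reach G A u v → v ∈ K) →
                 ∀ {v} → Reach G A u v → Reach G K u v
  reach-within ⊆K p@(here _)     = here (⊆K p)
  reach-within ⊆K p@(step q _ e) = step (reach-within ⊆K q) (⊆K p) e

  IsComponent : Subset N → Fin N → Subset N → Set
  IsComponent A u C = (∀ {v} → v ∈ C → Reach G A u v) × (∀ {v} → Reach G A u v → v ∈ C)

  saturate : ∀ A u m C → u ∈ C → (∀ {v} → v ∈ C → Reach G A u v) →
             ∣ A ∣ ≤ m + ∣ C ∣ → ∃ (IsComponent A u)
  saturate A u m C u∈C sound le
    with any? (λ w → (w ∈? A) ×-dec (¬? (w ∈? C) ×-dec any? (λ v → (v ∈? C) ×-dec edge? G v w)))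
  ... | no closed = C , sound , complete
    where
    complete : ∀ {v} → Reach G A u v → v ∈ C
    complete (here _) = u∈C
    complete (step {v} {w} p w∈A e) = decidable-stable (w ∈? C) λ w∉C →
      closed (w , w∈A , w∉C , v , complete p , e)
  saturate A u zero C u∈C sound le | yes (w , w∈A , w∉C , _) =
    ⊥-elim (no-fuel (reach-target ∘ sound) w∈A w∉C le)
  saturate A u (suc m) C u∈C sound le | yes (w , w∈A , w∉C , v , v∈C , e) =
    saturate A u m (C ⊕ w) (⊆⊕ C w u∈C) sound' (fuel-⊕ m C A w∉C le)
    where
    sound' : ∀ {x} → x ∈ C ⊕ w → Reach G A u x
    sound' x∈ with ∈⊕⁻ C w x∈
    ... | inj₁ x∈C  = sound x∈C
    ... | inj₂ refl = step (sound v∈C) w∈A e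

  component : ∀ A u → ∃ (IsComponent A u)
  component A u with u ∈? A
  ... | no u∉A  = ⊥ˢ , (λ v∈ → ⊥-elim (Subₚ.∉⊥ v∈)) , λ p → ⊥-elim (u∉A (reach-source p))
  ... | yes u∈A = saturate A u ∣ A ∣ ⁅ u ⁆ (Subₚ.x∈⁅x⁆ u) sound (ℕₚ.m≤m+n _ _)
    where
    sound : ∀ {v} → v ∈ ⁅ u ⁆ → Reach G A u v
    sound v∈ with Subₚ.x∈⁅y⁆⇒x≡y u v∈
    ... | refl = here u∈A

  reach? : ∀ A u v → Dec (Reach G A u v)
  reach? A u v with component A u
  ... | C , sound , complete with v ∈? C
  ...   | yes v∈C = yes (sound v∈C)
  ...   | no  v∉C = no (v∉C ∘ complete)

  rIndep-⊆ : ∀ r {A B} → A ⊆ B → RIndep r G B → RIndep r G A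
  rIndep-⊆ r A⊆B ind u f inj reach = ind u f inj (reach-mono A⊆B ∘ reach)

  rIndep? : ∀ r A → Dec (RIndep r G A)
  rIndep? r A with any? (λ u → r <? ∣ proj₁ (component A u) ∣)
  ... | no small = yes λ u f inj reach →
          small (u , injective⇒≤∣∣ (suc r) (proj₁ (component A u)) f inj
                       (proj₂ (proj₂ (component A u)) ∘ reach))
  ... | yes (u , r<∣C∣) with component A u
  ...   | C , sound , _ with enumerate C
  ...     | f , inj , f∈ = no λ ind →
            ind u (λ i → f (inject≤ i r<∣C∣))
                (λ eq → Finₚ.inject≤-injective r<∣C∣ r<∣C∣ _ _ (inj eq))
                (λ i → sound (f∈ (inject≤ i r<∣C∣)))

  -- A component of `F ⊕ u` either contains `u`, and then lies in the `r`-independent set `K`, or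
  -- avoids `u`, and then is connected inside `F`.
  rIndep-add : ∀ r {F K} u → RIndep r G F → RIndep r G K →
               (∀ {v} → Reach G (F ⊕ u) u v → v ∈ K) → RIndep r G (F ⊕ u)
  rIndep-add r {F} {K} u indF indK ⊆K s f inj reach with reach? (F ⊕ u) s u
  ... | yes s→u = indK u f inj λ i → reach-within ⊆K (reach-trans (reach-sym s→u) (reach i))
  ... | no s↛u = indF s f inj (avoid ∘ reach)
    where
    ∈F : ∀ {v} → Reach G (F ⊕ u) s v → v ∈ F
    ∈F p with ∈⊕⁻ F u (reach-target p)
    ... | inj₁ v∈F  = v∈F
    ... | inj₂ refl = ⊥-elim (s↛u p)
    avoid : ∀ {v} → Reach G (F ⊕ u) s v → Reach G F s v
    avoid = reach-within ∈F

  -- Substituting u for w maps every component of F ∪ {w} injectively into one of F ∪ {u}.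
  rIndep-exchange : ∀ r {F} u w → u ∉ F → w ∉ F →
                    (∀ {v} → v ∈ F → Edge G w v → Reach G (F ⊕ u) u v) →
                    RIndep r G (F ⊕ u) → RIndep r G (F ⊕ w)
  rIndep-exchange r {F} u w u∉F w∉F nbr ind s f inj reach =
    ind (σ s) (σ ∘ f) (λ {i} {j} eq → inj (σ-inj (reach-target (reach i)) (reach-target (reach j)) eq))
        (σ-reach ∘ reach)
    where
    σ : Fin N → Fin N
    σ v with v Finₚ.≟ w
    ... | yes _ = u
    ... | no  _ = v
    σ-inj : ∀ {a b} → a ∈ F ⊕ w → b ∈ F ⊕ w → σ a ≡ σ b → a ≡ b
    σ-inj {a} {b} a∈ b∈ eq with a Finₚ.≟ w | b Finₚ.≟ w
    ... | yes refl | yes refl = refl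
    ... | no _     | no _     = eq
    ... | yes refl | no b≢w with ∈⊕⁻ F w b∈
    ...   | inj₁ b∈F = ⊥-elim (u∉F (subst (_∈ F) (≡-sym eq) b∈F))
    ...   | inj₂ b≡w = ⊥-elim (b≢w b≡w)
    σ-inj {a} {b} a∈ b∈ eq | no a≢w | yes refl with ∈⊕⁻ F w a∈
    ...   | inj₁ a∈F = ⊥-elim (u∉F (subst (_∈ F) eq a∈F))
    ...   | inj₂ a≡w = ⊥-elim (a≢w a≡w)
    ∈F : ∀ {v} → v ∈ F ⊕ w → v ≢ w → v ∈ F
    ∈F v∈ v≢w = [ id , ⊥-elim ∘ v≢w ]′ (∈⊕⁻ F w v∈)
    σ-edge : ∀ {a b} → a ∈ F ⊕ w → b ∈ F ⊕ w → Edge G a b → Reach G (F ⊕ u) (σ a) (σ b)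
    σ-edge {a} {b} a∈ b∈ e with a Finₚ.≟ w | b Finₚ.≟ w
    ... | yes refl | yes refl = ⊥-elim (edge-irrefl G e)
    -- Only components matter, so the neighbours of `w` need to be reachable from `u`, not adjacent
    -- to it.
    ... | yes refl | no b≢w   = nbr (∈F b∈ b≢w) e
    ... | no a≢w   | yes refl = reach-sym (nbr (∈F a∈ a≢w) (edge-sym G e))
    ... | no a≢w   | no b≢w   = step (here (⊆⊕ F u (∈F a∈ a≢w))) (⊆⊕ F u (∈F b∈ b≢w)) e
    σ-∈ : ∀ {v} → v ∈ F ⊕ w → σ v ∈ F ⊕ u
    σ-∈ {v} v∈ with v Finₚ.≟ w
    ... | yes _   = ∈⊕ F u
    ... | no v≢w = ⊆⊕ F u (∈F v∈ v≢w)
    σ-reach : ∀ {v} → Reach G (F ⊕ w) s v → Reach G (F ⊕ u) (σ s) (σ v)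
    σ-reach (here s∈)     = here (σ-∈ s∈)
    σ-reach (step p w∈ e) = reach-trans (σ-reach p) (σ-edge (reach-target p) w∈ e)

-- Chordal graphs

least : {Q : ℕ → Set} → Decidable Q → ∀ k →
        (∀ i → i ≤ k → ¬ Q i) ⊎ ∃[ m ] m ≤ k × Q m × (∀ i → i < m → ¬ Q i)
least Q? zero with Q? 0
... | yes q = inj₂ (0 , z≤n , q , λ _ ())
... | no ¬q = inj₁ λ { zero z≤n → ¬q }
least {Q} Q? (suc k) with least Q? k
... | inj₂ (m , m≤k , q , min) = inj₂ (m , ℕₚ.m≤n⇒m≤1+n m≤k , q , min)
... | inj₁ none with Q? (suc k)
...   | yes q = inj₂ (suc k , ≤-refl , q , λ i → none i ∘ ℕₚ.≤-pred)
...   | no ¬q = inj₁ none'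
  where
  none' : ∀ i → i ≤ suc k → ¬ Q i
  none' i i≤ with ℕₚ.m≤n⇒m<n∨m≡n i≤
  ... | inj₁ (s≤s i≤k) = none i i≤k
  ... | inj₂ refl      = ¬q

module _ {n : ℕ} (H : Graph n) (chordal : Chordal H) {P : Fin n → Set} (P? : Decidable P) where

  private
    cons : Fin n → (ℕ → Fin n) → ℕ → Fin n
    cons z p zero    = z
    cons z p (suc i) = p i

  -- Only the entries `p 0` to `p k` count. With a total function on ℕ, prepending a vertex is a
  -- mere shift of the index.
  record InducedPath (k : ℕ) (p : ℕ → Fin n) : Set where
    field
      inside    : ∀ i → i ≤ k → P (p i)
      injective : ∀ i j → i ≤ k → j ≤ k → p i ≡ p j → i ≡ j
      edges     : ∀ i → i < k → Edge H (p i) (p (suc i))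
      induced   : ∀ i j → i ≤ k → j ≤ k → Edge H (p i) (p j) → suc i ≡ j ⊎ suc j ≡ i

  open InducedPath

  -- For adjacent `x` and `y` in `P` this is the inclusion N[x] ⊆ N[y] of closed neighbourhoods in
  -- the subgraph induced on `P`.
  Dominated : Fin n → Fin n → Set
  Dominated x y = ∀ z → P z → Edge H x z → z ≡ y ⊎ Edge H y z

  module _ {k p} (path : InducedPath (suc k) p) (z : Fin n)
           (z~p₀ : Edge H (p 0) z) (z≢p₁ : z ≢ p 1) (z≁p₁ : ¬ Edge H (p 1) z) where

    private
      z∉p : ∀ i → i ≤ suc k → z ≢ p i
      z∉p zero          _  refl = edge-irrefl H z~p₀
      z∉p (suc zero)    _  eq   = z≢p₁ eq
      -- As the path is induced, `p 1` is its only vertex adjacent to `p 0`.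
      z∉p (suc (suc i)) i≤ refl with induced path 0 (suc (suc i)) z≤n i≤ z~p₀
      ... | inj₁ ()
      ... | inj₂ ()

      cons-injective : ∀ i j → i ≤ suc (suc k) → j ≤ suc (suc k) → cons z p i ≡ cons z p j → i ≡ j
      cons-injective zero    zero    _        _        _  = refl
      cons-injective zero    (suc j) _        (s≤s j≤) eq = ⊥-elim (z∉p j j≤ eq)
      cons-injective (suc i) zero    (s≤s i≤) _        eq = ⊥-elim (z∉p i i≤ (≡-sym eq))
      cons-injective (suc i) (suc j) (s≤s i≤) (s≤s j≤) eq = cong suc (injective path i j i≤ j≤ eq)

      cons-edges : ∀ i → i < suc (suc k) → Edge H (cons z p i) (cons z p (suc i))
      cons-edges zero    _        = edge-sym H z~p₀
      cons-edges (suc i) (s≤s i<) = edges path i i<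

    lengthen : P z → (∀ i → i ≤ k → ¬ Edge H z (p (suc i))) → InducedPath (suc (suc k)) (cons z p)
    lengthen Pz free = record
      { inside = inside'; injective = cons-injective; edges = cons-edges; induced = induced' }
      where
      inside' : ∀ i → i ≤ suc (suc k) → P (cons z p i)
      inside' zero    _        = Pz
      inside' (suc i) (s≤s i≤) = inside path i i≤
      induced' : ∀ i j → i ≤ suc (suc k) → j ≤ suc (suc k) →
                 Edge H (cons z p i) (cons z p j) → suc i ≡ j ⊎ suc j ≡ i
      induced' zero          zero          _        _              e = ⊥-elim (edge-irrefl H e)
      induced' zero          (suc zero)    _        _              e = inj₁ refl
      induced' zero          (suc (suc j)) _        (s≤s (s≤s j≤)) e = ⊥-elim (free j j≤ e)
      induced' (suc zero)    zero          _        _              e = inj₂ refl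
      induced' (suc (suc i)) zero          (s≤s (s≤s i≤)) _        e = ⊥-elim (free i i≤ (edge-sym H e))
      induced' (suc i)       (suc j)       (s≤s i≤) (s≤s j≤)       e =
        Sum.map (cong suc) (cong suc) (induced path i j i≤ j≤ e)

    -- If `p (suc m)` is the first vertex after `p 0` adjacent to `z`, then `z`, `p 0`, ...,
    -- `p (suc m)` form a chordless cycle of length `m + 3`. For `m = 0` the edge contradicts
    -- `z≁p₁`; otherwise the length is at least 4, against chordality.
    no-return : ∀ m → m ≤ k → Edge H z (p (suc m)) → ¬ (∀ i → i < m → ¬ Edge H z (p (suc i)))
    no-return zero    _   e _   = z≁p₁ (edge-sym H e)
    no-return (suc m) m≤k e min with chordal (suc (suc (suc (suc m)))) (s≤s (s≤s (s≤s (s≤s z≤n)))) c cycle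
      where
      c : Fin (suc (suc (suc (suc m)))) → Fin n
      c i = cons z p (toℕ i)
      bound : ∀ (i : Fin (suc (suc (suc (suc m))))) → toℕ i ≤ suc (suc k)
      bound i = ≤-trans (ℕₚ.≤-pred (toℕ<n i)) (s≤s (s≤s m≤k))
      cycEdge : ∀ i j → CycAdj _ i j → Edge H (c i) (c j)
      cycEdge i j (inj₁ eq) =
        subst (λ a → Edge H (c i) (cons z p a)) eq
          (cons-edges (toℕ i) (≤-trans (≤-reflexive eq) (bound j)))
      cycEdge i j (inj₂ (inj₁ eq)) = edge-sym H (subst (λ a → Edge H (c j) (cons z p a)) eq
          (cons-edges (toℕ j) (≤-trans (≤-reflexive eq) (bound i))))
      cycEdge i j (inj₂ (inj₂ (inj₁ (i≡0 , j≡last)))) rewrite i≡0 | ℕₚ.suc-injective j≡last = e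
      cycEdge i j (inj₂ (inj₂ (inj₂ (j≡0 , i≡last)))) rewrite j≡0 | ℕₚ.suc-injective i≡last = edge-sym H e
      cycle : IsCycle H _ c
      cycle = (λ {i} {j} eq → toℕ-injective (cons-injective _ _ (bound i) (bound j) eq)) , cycEdge
    ... | i , j , _ , ¬adj , e' = ¬adj (chordless (toℕ i) (toℕ j) (toℕ<n i) (toℕ<n j) e')
      where
      L : ℕ
      L = suc (suc (suc (suc m)))
      -- By minimality, a neighbour of `z` at cycle position `b + 2` can only sit at the last
      -- position.
      far : ∀ b → suc (suc b) < L → Edge H z (p (suc b)) → suc (suc (suc b)) ≡ L
      far b b< e″ with ℕₚ.m≤n⇒m<n∨m≡n b<
      ... | inj₁ (s≤s (s≤s (s≤s b<'))) = ⊥-elim (min b b<' e″)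
      ... | inj₂ eq = eq
      chordless : ∀ a b → a < L → b < L → Edge H (cons z p a) (cons z p b) →
                  (suc a ≡ b) ⊎ (suc b ≡ a) ⊎ ((a ≡ 0) × (suc b ≡ L)) ⊎ ((b ≡ 0) × (suc a ≡ L))
      chordless zero          zero          _ _ e″ = ⊥-elim (edge-irrefl H e″)
      chordless zero          (suc zero)    _ _ e″ = inj₁ refl
      chordless zero          (suc (suc b)) _ l e″ = inj₂ (inj₂ (inj₁ (refl , far b l e″)))
      chordless (suc zero)    zero          _ _ e″ = inj₂ (inj₁ refl)
      chordless (suc (suc a)) zero          l _ e″ =
        inj₂ (inj₂ (inj₂ (refl , far a l (edge-sym H e″))))
      chordless (suc a) (suc b) (s≤s (s≤s a≤)) (s≤s (s≤s b≤)) e″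
        with induced path a b (≤-trans a≤ (s≤s m≤k)) (≤-trans b≤ (s≤s m≤k)) e″
      ... | inj₁ eq = inj₁ (cong suc eq)
      ... | inj₂ eq = inj₂ (inj₁ (cong suc eq))

  -- In a chordal graph, an inclusion-maximal induced path ends in a vertex dominated by its predecessor.
  dominated-end : ∀ m k p → InducedPath (suc k) p → n ≤ m + suc k →
                  ∃[ x ] ∃[ y ] P x × P y × Edge H x y × Dominated x y
  dominated-end m k p path n≤
    with any? (λ z → P? z ×-dec (edge? H (p 0) z ×-dec (¬? (z Finₚ.≟ p 1) ×-dec ¬? (edge? H (p 1) z))))
  ... | no none = p 0 , p 1 , inside path 0 z≤n , inside path 1 (s≤s z≤n) , edges path 0 (s≤s z≤n) , dom
    where
    dom : Dominated (p 0) (p 1)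
    dom z Pz e with z Finₚ.≟ p 1 | edge? H (p 1) z
    ... | yes eq | _      = inj₁ eq
    ... | no  _  | yes e' = inj₂ e'
    ... | no  ne | no ¬e  = ⊥-elim (none (z , Pz , e , ne , ¬e))
  ... | yes (z , Pz , e , ne , ¬e) with least (λ i → edge? H z (p (suc i))) k
  ...   | inj₂ (i , i≤k , e' , min) = ⊥-elim (no-return path z e ne ¬e i i≤k e' min)
  -- The path would have `k + 2` distinct vertices, while `n ≤ k + 1`.
  dominated-end zero k p path n≤ | yes _ | inj₁ _ =
    ⊥-elim (ℕₚ.<⇒≱ (Finₚ.injective⇒≤ {f = λ (i : Fin (suc (suc k))) → p (toℕ i)}
      λ {i} {j} eq → toℕ-injective
        (injective path _ _ (ℕₚ.≤-pred (toℕ<n i)) (ℕₚ.≤-pred (toℕ<n j)) eq)) n≤)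
  dominated-end (suc m) k p path n≤ | yes (z , Pz , e , ne , ¬e) | inj₁ free =
    dominated-end m (suc k) (cons z p) (lengthen path z e ne ¬e Pz free)
      (≤-trans n≤ (≤-reflexive (≡-sym (ℕₚ.+-suc m (suc k)))))

  dominated-exists : ∀ {a b} → P a → P b → Edge H a b →
                     ∃[ x ] ∃[ y ] P x × P y × Edge H x y × Dominated x y
  dominated-exists {a} {b} Pa Pb e = dominated-end n 0 p path (ℕₚ.m≤m+n n 1)
    where
    p : ℕ → Fin n
    p zero    = a
    p (suc _) = b
    path : InducedPath 1 p
    path .inside zero    _ = Pa
    path .inside (suc _) _ = Pb
    path .injective zero       zero       _         _         _    = refl
    path .injective zero       (suc _)    _         _         refl = ⊥-elim (edge-irrefl H e)
    path .injective (suc _)    zero       _         _         refl = ⊥-elim (edge-irrefl H e)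
    path .injective (suc zero) (suc zero) _         _         _    = refl
    path .injective (suc (suc _)) (suc _) (s≤s ()) _ _
    path .injective (suc zero) (suc (suc _)) _ (s≤s ()) _
    path .edges zero    _  = e
    path .edges (suc _) (s≤s ())
    path .induced zero       zero       _ _ e' = ⊥-elim (edge-irrefl H e')
    path .induced zero       (suc zero) _ _ _  = inj₁ refl
    path .induced (suc zero) zero       _ _ _  = inj₂ refl
    path .induced (suc _)    (suc _)    _ _ e' = ⊥-elim (edge-irrefl H e')
    path .induced zero (suc (suc _)) _ (s≤s ()) _
    path .induced (suc (suc _)) zero (s≤s ()) _ _

-- Clique-corona graphs

module _ {n N : ℕ} {H : Graph n} {G : Graph N} {t : ℕ} (ccg : IsCCGAll H G t) where

  open IsCCGAll ccg

  center : Fin N → Fin n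
  center v = [ id , proj₁ ]′ (role v)

  data Kind (v : Fin N) : Set where
    old : ∀ a → v ≡ copy a → Kind v
    new : ∀ x b → role v ≡ inj₂ (x , b) → Kind v

  kind : ∀ v → Kind v
  kind v with role v in eq
  ... | inj₁ a       = old a (copy-uniq v a eq)
  ... | inj₂ (x , b) = new x b eq

  center-copy : ∀ a → center (copy a) ≡ a
  center-copy a = cong [ id , proj₁ ]′ (copy-role a)

  center-new : ∀ {v x b} → role v ≡ inj₂ (x , b) → center v ≡ x
  center-new = cong [ id , proj₁ ]′

  copy-injective : ∀ {a b} → copy a ≡ copy b → a ≡ b
  copy-injective eq = trans (≡-sym (center-copy _)) (trans (cong center eq) (center-copy _))

  new≢copy : ∀ {v x b a} → role v ≡ inj₂ (x , b) → v ≢ copy a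
  new≢copy rv refl with trans (≡-sym rv) (copy-role _)
  ... | ()

  edge-copy : ∀ {a b} → Edge H a b → Edge G (copy a) (copy b)
  edge-copy {a} {b} e = trans (adj-HH a b) e

  -- A star-clique meets the rest of `G` only at its hub, so an edge between different star-cliques
  -- comes from `H`.
  edge-centers : ∀ {v w} → Edge G v w →
                 center v ≡ center w ⊎ (∃[ a ] ∃[ b ] v ≡ copy a × w ≡ copy b × Edge H a b)
  edge-centers {v} {w} e with kind v | kind w
  ... | old a refl | old b refl = inj₂ (a , b , refl , refl , trans (≡-sym (adj-HH a b)) e)
  ... | old a refl | new x b rw = inj₁ (trans (center-copy a)
          (trans (proj₁ (adj-HN w a x b rw) (edge-sym G e)) (≡-sym (center-new rw))))
  ... | new x b rv | old a refl = inj₁ (trans (center-new rv)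
          (trans (≡-sym (proj₁ (adj-HN v a x b rv) e)) (≡-sym (center-copy a))))
  ... | new x b rv | new y c rw = inj₁ (trans (center-new rv)
          (trans (proj₁ (proj₁ (adj-NN v w x b y c rv rw) e)) (≡-sym (center-new rw))))

  hub-edge : ∀ {v} → v ≢ copy (center v) → Edge G v (copy (center v))
  hub-edge {v} v≢ with kind v
  ... | old a refl = ⊥-elim (v≢ (cong copy (≡-sym (center-copy a))))
  ... | new x b rv = proj₂ (adj-HN v (center v) x b rv) (center-new rv)

  reach-from-hub : ∀ {X u v y} → Reach G X u (copy y) → v ∈ X → center v ≡ y → Reach G X u v
  reach-from-hub {v = v} p v∈X refl with v Finₚ.≟ copy (center v)
  ... | yes eq = subst (Reach G _ _) (≡-sym eq) p
  ... | no ne  = step p v∈X (edge-sym G (hub-edge ne))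

  -- All neighbours of a new vertex lie in its star-clique, hence are the hub or adjacent to it.
  reach-new-neighbour : ∀ {X u z v y c} → Reach G X u (copy y) → role z ≡ inj₂ (y , c) →
                        v ∈ X → Edge G z v → Reach G X u v
  reach-new-neighbour p rz v∈X e with edge-centers e
  ... | inj₁ eq               = reach-from-hub p v∈X (trans (≡-sym eq) (center-new rz))
  ... | inj₂ (_ , _ , eq , _) = ⊥-elim (new≢copy rz eq)

  -- Star-cliques and their hubs

  starClique : Fin n → Subset N
  starClique x = comprehension (λ v → center v Finₚ.≟ x)

  star : ∀ x → Fin (suc t) → Fin N
  star x zero    = copy x
  star x (suc i) = proj₁ (size x) i

  star-center : ∀ x i → center (star x i) ≡ x
  star-center x zero    = center-copy x
  star-center x (suc i) = center-new (proj₂ (proj₂ (proj₂ (size x)) i))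

  star-injective : ∀ x → Injective _≡_ _≡_ (star x)
  star-injective x {zero}  {zero}  _  = refl
  star-injective x {zero}  {suc j} eq = ⊥-elim (new≢copy (proj₂ (proj₂ (proj₂ (size x)) j)) (≡-sym eq))
  star-injective x {suc i} {zero}  eq = ⊥-elim (new≢copy (proj₂ (proj₂ (proj₂ (size x)) i)) eq)
  star-injective x {suc i} {suc j} eq = cong suc (proj₁ (proj₂ (size x)) eq)

  stars : Fin n → Fin n → Fin (suc t + suc t) → Fin N
  stars x y = [ star x , star y ]′ ∘ splitAt (suc t)

  stars-injective : ∀ {x y} → x ≢ y → Injective _≡_ _≡_ (stars x y)
  stars-injective {x} {y} x≢y {i} {j} eq =
    trans (≡-sym (Finₚ.join-splitAt (suc t) (suc t) i))
          (trans (cong (join (suc t) (suc t)) (sum-injective (splitAt (suc t) i) (splitAt (suc t) j) eq))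
                 (Finₚ.join-splitAt (suc t) (suc t) j))
    where
    sum-injective : ∀ a b → [ star x , star y ]′ a ≡ [ star x , star y ]′ b → a ≡ b
    sum-injective (inj₁ a) (inj₁ b) eq = cong inj₁ (star-injective x eq)
    sum-injective (inj₂ a) (inj₂ b) eq = cong inj₂ (star-injective y eq)
    sum-injective (inj₁ a) (inj₂ b) eq = ⊥-elim (x≢y
      (trans (≡-sym (star-center x a)) (trans (cong center eq) (star-center y b))))
    sum-injective (inj₂ a) (inj₁ b) eq = ⊥-elim (x≢y
      (trans (≡-sym (star-center x b)) (trans (cong center (≡-sym eq)) (star-center y a))))

  module _ (r : ℕ) where

    private
      Δ : Complex N
      Δ = Ind r G

      Δ? : ∀ F → Dec (Δ F)
      Δ? = rIndep? G r

    open Decomposition Δ Δ? (rIndep-⊆ G r)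

    -- A walk from `copy x` leaves the star-clique of `x` only along an edge of `H` at `x`, and `F`
    -- contains no such neighbour. The component of `copy x` therefore lies in a face.
    add-isolated : ∀ {F} x → Δ (starClique x) → Δ F → (∀ a → copy a ∈ F → ¬ Edge H x a) →
                   Δ (F ⊕ copy x)
    add-isolated {F} x ΔS ΔF isolated =
      rIndep-add G r (copy x) ΔF ΔS (∈-comprehension⁺ (λ v → center v Finₚ.≟ x) ∘ stays)
      where
      stays : ∀ {v} → Reach G (F ⊕ copy x) (copy x) v → center v ≡ x
      stays (here _) = center-copy x
      stays (step p w∈ e) with edge-centers e
      ... | inj₁ eq = trans (≡-sym eq) (stays p)
      ... | inj₂ (a , b , refl , refl , h) with trans (≡-sym (center-copy a)) (stays p)
      ...   | refl with ∈⊕⁻ F (copy x) w∈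
      ...     | inj₁ b∈F = ⊥-elim (isolated b b∈F h)
      ...     | inj₂ eq  = trans (cong center eq) (center-copy x)

    -- Once only new vertices are undecided, the undecided vertices in one component of D are
    -- interchangeable.
    module _ {A D : Subset N} (old-decided : ∀ a → copy a ∈ D → copy a ∈ A)
             {u : Fin N} {x : Fin n} {b : ℕ} (ru : role u ≡ inj₂ (x , b)) where

      -- A walk from `u` stays in the clique of `u` until it meets the hub `copy x`. Every hub it
      -- passes is in `D`, hence in `A`, so from then on the hub of the current vertex is reachable
      -- inside `A`.
      component-shape : ∀ {v} → Reach G D u v →
                        role v ≡ inj₂ (x , b) ⊎ Reach G A (copy x) (copy (center v))
      component-shape (here _) = inj₁ ru
      component-shape (step {v} {w} p w∈D e) with component-shape p
      component-shape (step {v} {w} p w∈D e) | inj₁ rv with kind w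
      ... | old a refl with proj₁ (adj-HN v a x b rv) e
      ...   | refl = inj₂ (subst (Reach G A (copy x) ∘ copy) (≡-sym (center-copy x))
                             (here (old-decided x w∈D)))
      component-shape (step {v} {w} p w∈D e) | inj₁ rv | new y c rw
        with proj₁ (adj-NN v w x b y c rv rw) e
      ... | refl , refl , _ = inj₁ rw
      component-shape (step {v} {w} p w∈D e) | inj₂ q with edge-centers e
      ... | inj₁ eq = inj₂ (subst (Reach G A (copy x) ∘ copy) eq q)
      ... | inj₂ (a , a' , refl , refl , h) =
        inj₂ (subst (Reach G A (copy x) ∘ copy) (≡-sym (center-copy a'))
               (step (subst (Reach G A (copy x) ∘ copy) (center-copy a) q)
                     (old-decided a' w∈D) (edge-copy h)))

      -- If `w` lies in the clique of `u`, its neighbours in `F` are neighbours of `u`. Otherwise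
      -- `u` reaches the hub of `w` through `A`, and every neighbour of `w` in `F` hangs on that
      -- hub.
      exchange-new : ∀ {F w} → A ⊆ F → u ∉ F → w ∉ F → Reach G D u w → Δ (F ⊕ u) → Δ (F ⊕ w)
      exchange-new {F} {w} A⊆F u∉F w∉F p with kind w
      ... | old a refl = ⊥-elim (w∉F (A⊆F (old-decided a (reach-target G p))))
      ... | new y c rw = rIndep-exchange G r u w u∉F w∉F (nbr (component-shape p))
        where
        nbr : role w ≡ inj₂ (x , b) ⊎ Reach G A (copy x) (copy (center w)) →
              ∀ {v} → v ∈ F → Edge G w v → Reach G (F ⊕ u) u v
        nbr (inj₂ q) {v} v∈F e =
          reach-new-neighbour
            (reach-trans G (step (here (∈⊕ F u)) (reach-source G q')
                             (proj₂ (adj-HN u x x b ru) refl)) q')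
            rw (⊆⊕ F u v∈F) e
          where
          q' : Reach G (F ⊕ u) (copy x) (copy y)
          q' = subst (Reach G (F ⊕ u) (copy x) ∘ copy) (center-new rw)
                 (reach-mono G (⊆⊕ F u ∘ A⊆F) q)
        nbr (inj₁ rw') {v} v∈F e = step (here (∈⊕ F u)) (⊆⊕ F u v∈F) edge
          where
          edge : Edge G u v
          edge with kind v
          ... | old a refl = proj₂ (adj-HN u a x b ru) (proj₁ (adj-HN w a x b rw') e)
          ... | new y' c' rv with proj₁ (adj-NN w v x b y' c' rw' rv) e
          ...   | eq₁ , eq₂ , _ = proj₂ (adj-NN u v x b y' c' ru rv) (eq₁ , eq₂ , λ { refl → u∉F v∈F })

    decomposable-new : ∀ m A D → A ⊆ D → (∀ a → copy a ∈ D → copy a ∈ A) →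
                       ∣ D ∣ ≤ m + ∣ A ∣ → Decomposable A D
    decomposable-new m A D A⊆D old-decided le
      with any? (λ u → (u ∈? D) ×-dec ¬? (u ∈? A)) | Δ? A
    ... | no none | no ¬ΔA = nonface ¬ΔA
    ... | no none | yes ΔA = leaf ΔA A⊆D λ {v} v∈D →
            decidable-stable (v ∈? A) λ v∉A → none (v , v∈D , v∉A)
    decomposable-new zero A D A⊆D old-decided le | yes (u , u∈D , u∉A) | _ =
      ⊥-elim (no-fuel A⊆D u∈D u∉A le)
    decomposable-new (suc m) A D A⊆D old-decided le | yes (u , u∈D , u∉A) | _ with kind u
    ... | old a refl = ⊥-elim (u∉A (old-decided a u∈D))
    ... | new x b ru with component G D u
    ...   | K , sound , complete with Δ? K
    -- In a face inside `D` the added vertex `u` gets a component contained in `K`, so adding it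
    -- never leaves the complex.
    ...     | yes ΔK = cone u apex
                (decomposable-new m (A ⊕ u) D (⊕-least A⊆D u∈D)
                  (λ a → ⊆⊕ A u ∘ old-decided a) (fuel-⊕ m A D u∉A le))
      where
      apex : ∀ F → LocalFacet A D F → u ∈ F
      apex F (localFacet face _ upper maximal) = decidable-stable (u ∈? F) λ u∉F →
        maximal u∈D u∉F (rIndep-add G r u face ΔK (complete ∘ reach-mono G (⊕-least upper u∈D)))
    ...     | no ¬ΔK = shed u u∈D u∉A shedding
                (decomposable-new m A (D - u)
                  (λ v∈A → Subₚ.x∈p∧x≢y⇒x∈p-y (A⊆D v∈A) λ { refl → u∉A v∈A })
                  (λ a → old-decided a ∘ -⊆ D u) (fuel-- m A D u∈D le))
                (decomposable-new m (A ⊕ u) D (⊕-least A⊆D u∈D)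
                  (λ a → ⊆⊕ A u ∘ old-decided a) (fuel-⊕ m A D u∉A le))
      where
      shedding : ∀ F → LocalFacet A (D - u) F → ¬ Δ (F ⊕ u)
      shedding F (localFacet face lower upper maximal) ΔFu = ¬ΔK (rIndep-⊆ G r K⊆ ΔFu)
        where
        K⊆ : K ⊆ F ⊕ u
        -- A vertex `w` of `K` missing from `F ⊕ u` could take the place of `u`, making `F ⊕ w` a
        -- face although `F` is maximal.
        K⊆ {w} w∈K = decidable-stable (w ∈? F ⊕ u) λ w∉Fu →
          maximal (Subₚ.x∈p∧x≢y⇒x∈p-y (reach-target G (sound w∈K)) λ { refl → w∉Fu (∈⊕ F u) })
                  (w∉Fu ∘ ⊆⊕ F u)
                  (exchange-new old-decided ru lower (∉- D u ∘ upper) (w∉Fu ∘ ⊆⊕ F u) (sound w∈K) ΔFu)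

    -- Deciding the vertices of `H`

    NewUndeleted : Subset N → Set
    NewUndeleted D = ∀ {v x b} → role v ≡ inj₂ (x , b) → v ∈ D

    -- A missing `z` could replace `copy x`, since the neighbours of `z` hang on the hub `copy y`,
    -- which `copy x` reaches. As `z` has not been deleted, the face `F ⊕ z` would contradict the
    -- maximality of `F`.
    new-full : ∀ {A D F x y z c} → NewUndeleted D → LocalFacet A (D - copy x) F → Δ (F ⊕ copy x) →
               Reach G (F ⊕ copy x) (copy x) (copy y) → role z ≡ inj₂ (y , c) → z ∈ F
    new-full {D = D} {F} {x} {z = z} newD (localFacet _ _ upper maximal) ΔFx p rz =
      decidable-stable (z ∈? F) λ z∉F →
        maximal (Subₚ.x∈p∧x≢y⇒x∈p-y (newD rz) (new≢copy rz)) z∉F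
          (rIndep-exchange G r (copy x) z (∉- D (copy x) ∘ upper) z∉F
            (λ v∈F → reach-new-neighbour p rz (⊆⊕ F (copy x) v∈F)) ΔFx)

    reach-star : ∀ {A D F x y v} → NewUndeleted D → LocalFacet A (D - copy x) F → Δ (F ⊕ copy x) →
                 Reach G (F ⊕ copy x) (copy x) (copy y) → center v ≡ y →
                 Reach G (F ⊕ copy x) (copy x) v
    reach-star {F = F} {x} {v = v} newD lf ΔFx p eq = reach-from-hub p v∈ eq
      where
      v∈ : v ∈ F ⊕ copy x
      v∈ with kind v
      ... | new y' b rv = ⊆⊕ F (copy x) (new-full newD lf ΔFx
              (subst (Reach G (F ⊕ copy x) (copy x) ∘ copy) (trans (≡-sym eq) (center-new rv)) p) rv)
      ... | old a refl = subst (_∈ F ⊕ copy x) (cong copy (trans (≡-sym eq) (center-copy a)))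
              (reach-target G p)

    module _ (r≤ : r ≤ 2 * t + 1) where

      -- Otherwise both star-cliques would lie in one component, which has at least 2t + 2 vertices.
      neighbour-sheds : ∀ {A D F x y} → NewUndeleted D → LocalFacet A (D - copy x) F →
                        copy y ∈ F → Edge H x y → ¬ Δ (F ⊕ copy x)
      neighbour-sheds {F = F} {x} {y} newD lf y∈F e ΔFx =
        ΔFx (copy x) (λ i → stars x y (inject≤ i bound))
            (λ eq → Finₚ.inject≤-injective bound bound _ _ (stars-injective x≢y eq))
            (λ i → reach (splitAt (suc t) (inject≤ i bound)))
        where
        bound : suc r ≤ suc t + suc t
        bound = s≤s (≤-trans r≤ (≤-reflexive
          (trans (ℕₚ.+-comm (2 * t) 1) (trans (cong (λ s → suc (t + s)) (ℕₚ.+-identityʳ t))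
            (≡-sym (ℕₚ.+-suc t t))))))
        x≢y : x ≢ y
        x≢y refl = edge-irrefl H e
        x→x : Reach G (F ⊕ copy x) (copy x) (copy x)
        x→x = here (∈⊕ F (copy x))
        reach : ∀ s → Reach G (F ⊕ copy x) (copy x) ([ star x , star y ]′ s)
        reach (inj₁ i) = reach-star newD lf ΔFx x→x (star-center x i)
        reach (inj₂ i) = reach-star newD lf ΔFx
          (step x→x (⊆⊕ F (copy x) y∈F) (edge-copy e)) (star-center y i)

      decomposable-old : Chordal H → ∀ m A D → A ⊆ D → NewUndeleted D →
                         ∣ D ∣ ≤ m + ∣ A ∣ → Decomposable A D
      decomposable-old chordal m A D A⊆D newD le = choose m le (any? open?)
        where
        Open : Fin n → Set
        Open a = copy a ∈ D × copy a ∉ A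

        open? : Decidable Open
        open? a = (copy a ∈? D) ×-dec ¬? (copy a ∈? A)

        choose : ∀ m → ∣ D ∣ ≤ m + ∣ A ∣ → Dec (∃ Open) → Decomposable A D
        choose m le (no none) = decomposable-new m A D A⊆D
          (λ a a∈D → decidable-stable (copy a ∈? A) λ a∉A → none (a , a∈D , a∉A)) le
        choose zero le (yes (x , x∈D , x∉A)) = ⊥-elim (no-fuel A⊆D x∈D x∉A le)
        choose (suc m) le (yes (x₀ , open₀)) =
          split (any? λ x → any? λ a → open? x ×-dec ((copy a ∈? A) ×-dec edge? H x a))
          where
          link : ∀ {x} → Open x → Decomposable (A ⊕ copy x) D
          link (x∈D , x∉A) =
            decomposable-old chordal m _ D (⊕-least A⊆D x∈D) newD (fuel-⊕ m A D x∉A le)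

          shed-old : ∀ {x} → Open x → (∀ F → LocalFacet A (D - copy x) F → ¬ Δ (F ⊕ copy x)) →
                     Decomposable A D
          shed-old {x} ox@(x∈D , x∉A) shedding = shed (copy x) x∈D x∉A shedding
            (decomposable-old chordal m A (D - copy x)
              (λ v∈A → Subₚ.x∈p∧x≢y⇒x∈p-y (A⊆D v∈A) λ { refl → x∉A v∈A })
              (λ rv → Subₚ.x∈p∧x≢y⇒x∈p-y (newD rv) (new≢copy rv))
              (fuel-- m A D x∈D le))
            (link ox)

          split : Dec (∃[ x ] ∃[ a ] Open x × copy a ∈ A × Edge H x a) → Decomposable A D
          -- `copy a` lies in every facet considered, so `x` always has a chosen neighbour.
          split (yes (x , a , ox , a∈A , e)) = shed-old ox λ F lf →
            neighbour-sheds newD lf (LocalFacet.lower lf a∈A) e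
          split (no separated)
            with any? (λ x → open? x ×-dec ¬? (Δ? (starClique x)))
          -- If `F ⊕ copy x` were a face, it would contain the whole star-clique of `x`.
          ... | yes (x , ox , ¬ΔS) = shed-old ox λ F lf ΔFx →
            ¬ΔS (rIndep-⊆ G r
              (λ v∈S → reach-target G (reach-star newD lf ΔFx (here (∈⊕ F (copy x)))
                         (∈-comprehension⁻ (λ v → center v Finₚ.≟ x) v∈S)))
              ΔFx)
          ... | no small with any? (λ x → any? λ y → open? x ×-dec (open? y ×-dec edge? H x y))
          -- No neighbour of `x₀` in `H` can be in `F`: a chosen one is excluded by `separated`, an
          -- open one by `edgeless`. The star-clique of `x₀` being a face, `copy x₀` can always be
          -- added.
          ...   | no edgeless = cone (copy x₀) apex (link open₀)
            where
            apex : ∀ F → LocalFacet A D F → copy x₀ ∈ F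
            apex F (localFacet face _ upper maximal) = decidable-stable (copy x₀ ∈? F) λ x₀∉F →
              maximal (proj₁ open₀) x₀∉F
                (add-isolated x₀ (decidable-stable (Δ? _) λ ¬ΔS → small (x₀ , open₀ , ¬ΔS)) face
                  λ a a∈F e → edgeless (x₀ , a , open₀ ,
                    (upper a∈F , λ a∈A → separated (x₀ , a , open₀ , a∈A , e)) , e))
          ...   | yes (a , b , oa , ob , e) with dominated-exists H chordal open? oa ob e
          ...     | x , y , ox , oy , x~y , dominated = shed-old oy shedding
            where
            -- Were `F ⊕ copy y` a face, `F` would contain no neighbour of `y`, by
            -- `neighbour-sheds`. Hence `F` misses `copy x` and, by domination, all neighbours of
            -- `x`; then `copy x` could be added, against maximality.
            shedding : ∀ F → LocalFacet A (D - copy y) F → ¬ Δ (F ⊕ copy y)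
            shedding F lf@(localFacet face _ upper maximal) ΔFy =
              maximal
                (Subₚ.x∈p∧x≢y⇒x∈p-y (proj₁ ox) λ eq →
                  edge-irrefl H (subst (Edge H x) (≡-sym (copy-injective eq)) x~y))
                (λ x∈F → neighbour-sheds newD lf x∈F (edge-sym H x~y) ΔFy)
                (add-isolated x (decidable-stable (Δ? _) λ ¬ΔS → small (x , ox , ¬ΔS)) face isolated)
              where
              isolated : ∀ a → copy a ∈ F → ¬ Edge H x a
              isolated a a∈F x~a
                with dominated a (-⊆ D (copy y) (upper a∈F) ,
                                  λ a∈A → separated (x , a , ox , a∈A , x~a)) x~a
              ... | inj₁ refl = ∉- D (copy y) (upper a∈F)
              ... | inj₂ y~a  = neighbour-sheds newD lf a∈F y~a ΔFy

      ind-shellable : Chordal H → Shellable Δ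
      ind-shellable chordal = decomposable⇒shellable
        (decomposable-old chordal ∣ ⊤ˢ {N} ∣ ⊥ˢ ⊤ˢ Subₚ.⊥⊆ (λ _ → Subₚ.∈⊤) (ℕₚ.m≤m+n _ _))

theorem5p2 : ∀ {n N : ℕ} (H : Graph n) (G : Graph N) (t r : ℕ) →
    1 ≤ t → Chordal H → IsCCGAll H G t →
    1 ≤ r → r ≤ 2 * t + 1 →
    Shellable (Ind r G)
theorem5p2 H G t r _ chordal ccg _ r≤ = ind-shellable ccg r r≤ chordal
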